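{- There is an infinite family of graphs $G$ whose stretch-width $\mathrm{stw}(G)$ is bounded by a constant and whose clique-width is in $\Omega(\log |V(G)|/\log\log|V(G)|)$.
   Context: All graphs are finite and simple. A partition sequence of an $n$-vertex graph $G$ is a sequence $\mathcal P_n,\dots,\mathcal P_1$ of partitions of $V(G)$ such that $\mathcal P_n$ is the partition into singletons, $\mathcal P_1=\{V(G)\}$, and each $\mathcal P_i$ ($i<n$) is obtained from $\mathcal P_{i+1}$ by merging two parts. Two distinct parts $X,Y$ are inhomogeneous if there are $u,u'\in X$, $v,v'\in Y$ with $uv\in E(G)$, $u'v'\notin E(G)$. The red graph $\mathcal R(\mathcal P)$ has vertex set $\mathcal P$ and edges between inhomogeneous parts. For a total order $\prec$ on $V(G)$ and $X\subseteq V(G)$, the span $\langle X\rangle=\{v:\min X\preceq v\preceq\max X\}$; $X,Y$ conflict if their spans intersect. For $X\in\mathcal P$, a part $Y\in\mathcal P\setminus\{X\}$ interferes with $X$ if $Y$ conflicts with the union of the parts in the closed neighborhood of $X$ in $\mathcal R(\mathcal P)$; the stretch of $X$ is the number of parts interfering with $X$; the stretch of $\mathcal P$ is the maximum stretch of a part. $\mathrm{stw}(G,\prec)$ is the minimum over partition sequences of the maximum stretch of its partitions, and $\mathrm{stw}(G)=\min_\prec \mathrm{stw}(G,\prec)$. -}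

module Defs where

open import Data.Nat using (ℕ; zero; suc; _+_; _*_; _∸_; _≤_; _<_)
open import Data.Nat.Logarithm using (⌊log₂_⌋; ⌈log₂_⌉)
open import Data.Fin using (Fin; toℕ; splitAt; _≟_)
open import Data.Bool using (Bool; true; false; _∨_; _∧_; if_then_else_)
open import Data.Sum using (_⊎_; inj₁; inj₂)
open import Data.Product using (Σ; ∃; ∃-syntax; _×_; _,_)
open import Data.List using (List; length)
open import Data.List.Membership.Propositional using (_∈_)
open import Relation.Nullary using (¬_)
open import Relation.Nullary.Decidable using (⌊_⌋)
open import Relation.Binary.PropositionalEquality using (_≡_; _≢_)
open import Function.Bundles using (_↔_; Inverse)

record Graph : Set where
  field
    n      : ℕ
    adj    : Fin n → Fin n → Bool
    sym    : ∀ u v → adj u v ≡ adj v u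
    irrefl : ∀ u → adj u u ≡ false

open Graph public

-- Partitions of Fin n, represented by a labelling f : Fin n → ℕ;
-- the parts are the nonempty fibres of f (a part is named by its label).

Labelling : ℕ → Set
Labelling n = Fin n → ℕ

module _ {n : ℕ} where

  IsPart : Labelling n → ℕ → Set
  IsPart f y = ∃[ v ] f v ≡ y

  Singletons : Labelling n → Set
  Singletons f = ∀ u v → f u ≡ f v → u ≡ v

  Trivial : Labelling n → Set
  Trivial f = ∀ u v → f u ≡ f v

  MergeOf : Labelling n → Labelling n → Set
  MergeOf f g =
    ∃[ a ] ∃[ b ] (f a ≢ f b) ×
      (∀ u v → (g u ≡ g v →
                  (f u ≡ f v) ⊎ (((f u ≡ f a) ⊎ (f u ≡ f b)) × ((f v ≡ f a) ⊎ (f v ≡ f b))))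
             × ((f u ≡ f v) ⊎ (((f u ≡ f a) ⊎ (f u ≡ f b)) × ((f v ≡ f a) ⊎ (f v ≡ f b)))
                  → g u ≡ g v))

-- A partition sequence P_n, ..., P_1 of an n-vertex graph, given as
-- P t = P_{n-t} for t = 0, ..., n-1.
record PartitionSequence (n : ℕ) : Set where
  field
    P       : ℕ → Labelling n
    start   : Singletons (P 0)
    step    : ∀ t → suc t ≤ n ∸ 1 → MergeOf (P t) (P (suc t))
    finish  : Trivial (P (n ∸ 1))

module _ (G : Graph) where

  Inhomogeneous : Labelling (n G) → ℕ → ℕ → Set
  Inhomogeneous f x y =
    (x ≢ y) ×
    (∃[ u ] ∃[ u′ ] ∃[ v ] ∃[ v′ ]
      (f u ≡ x) × (f u′ ≡ x) × (f v ≡ y) × (f v′ ≡ y) ×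
      (adj G u v ≡ true) × (adj G u′ v′ ≡ false))

  -- a total order on V(G) is given by a bijection pos : V(G) ↔ Fin n,
  -- u ≼ v iff toℕ (pos u) ≤ toℕ (pos v)
  Order : Set
  Order = Fin (n G) ↔ Fin (n G)

  module _ (ord : Order) where
    open Inverse ord using (to)

    _≼_ : Fin (n G) → Fin (n G) → Set
    u ≼ v = toℕ (to u) ≤ toℕ (to v)

    InSpan : (Fin (n G) → Set) → Fin (n G) → Set
    InSpan X w = ∃[ a ] ∃[ b ] X a × X b × (a ≼ w) × (w ≼ b)

    Conflict : (Fin (n G) → Set) → (Fin (n G) → Set) → Set
    Conflict X Y = ∃[ w ] InSpan X w × InSpan Y w

    module _ (f : Labelling (n G)) where

      PartSet : ℕ → Fin (n G) → Set
      PartSet y v = f v ≡ y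

      ClosedNbhdUnion : ℕ → Fin (n G) → Set
      ClosedNbhdUnion x w = (f w ≡ x) ⊎ Inhomogeneous f x (f w)

      Interferes : ℕ → ℕ → Set
      Interferes x y =
        IsPart f y × (y ≢ x) × Conflict (PartSet y) (ClosedNbhdUnion x)

      StretchOfPart≤ : ℕ → ℕ → Set
      StretchOfPart≤ x c =
        ∃[ L ] (length L ≤ c) × (∀ y → Interferes x y → y ∈ L)

      Stretch≤ : ℕ → Set
      Stretch≤ c = ∀ x → IsPart f x → StretchOfPart≤ x c

  StwOrd≤ : Order → ℕ → Set
  StwOrd≤ ord c =
    Σ (PartitionSequence (n G)) λ S →
      ∀ t → suc t ≤ n G → Stretch≤ ord (PartitionSequence.P S t) c

  Stw≤ : ℕ → Set
  Stw≤ c = ∃[ ord ] StwOrd≤ ord c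

data Expr (k : ℕ) : Set where
  vtx   : Fin k → Expr k
  _⊕_   : Expr k → Expr k → Expr k
  join  : (i j : Fin k) → i ≢ j → Expr k → Expr k
  relab : (i j : Fin k) → Expr k → Expr k

module _ {k : ℕ} where

  size : Expr k → ℕ
  size (vtx i)        = 1
  size (e₁ ⊕ e₂)      = size e₁ + size e₂
  size (join i j _ e) = size e
  size (relab i j e)  = size e

  label : (e : Expr k) → Fin (size e) → Fin k
  label (vtx i)        _ = i
  label (e₁ ⊕ e₂)      v with splitAt (size e₁) v
  ... | inj₁ v₁ = label e₁ v₁
  ... | inj₂ v₂ = label e₂ v₂
  label (join i j _ e) v = label e v
  label (relab i j e)  v = if ⌊ label e v ≟ i ⌋ then j else label e v

  eadj : (e : Expr k) → Fin (size e) → Fin (size e) → Bool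
  eadj (vtx i)        _ _ = false
  eadj (e₁ ⊕ e₂)      u v with splitAt (size e₁) u | splitAt (size e₁) v
  ... | inj₁ u₁ | inj₁ v₁ = eadj e₁ u₁ v₁
  ... | inj₂ u₂ | inj₂ v₂ = eadj e₂ u₂ v₂
  ... | inj₁ _  | inj₂ _  = false
  ... | inj₂ _  | inj₁ _  = false
  eadj (join i j _ e) u v =
    eadj e u v ∨ (⌊ label e u ≟ i ⌋ ∧ ⌊ label e v ≟ j ⌋)
               ∨ (⌊ label e u ≟ j ⌋ ∧ ⌊ label e v ≟ i ⌋)
  eadj (relab i j e)  u v = eadj e u v

Cw≤ : Graph → ℕ → Set
Cw≤ G k =
  Σ (Expr k) λ e → Σ (Fin (n G) ↔ Fin (size e)) λ φ →
    ∀ u v → adj G u v ≡ eadj e (Inverse.to φ u) (Inverse.to φ v)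

{-# OPTIONS --safe #-}
-- The graph on {0, …, 2^K − 1} joins p and q when |p − q| is a power of two dividing 2p and 2q.
--
-- Stretch-width: order the vertices naturally and use partitions into intervals, forgetting
-- the boundaries next to p in increasing order of the 2-adic valuation of p. While the
-- boundaries at valuation i are being forgotten, parts have length at most 2^(i+1), and a
-- vertex incident to an edge longer than 2^(i+1) is still a singleton, so it causes no red
-- edge of that length. A closed red neighbourhood thus spans a window of O(2^i) vertices,
-- which meets O(1) parts.
--
-- Clique-width: with K = 3m + 3 the odd multiples of 2^(2r) form m rows, and the vertices
-- c 2^(2m+3) + 2^h (h ≤ 2m) form m columns crossing all rows. A minimal subexpression
-- containing a whole row or a whole column meets all lines of the other kind, while its two
-- halves contain none; each line then has an edge leaving one of the halves, and the
-- endpoints of these edges inside a half have distinct labels. Hence m ≤ 2k.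
module Submission where

open import Defs
open import Data.Nat using (ℕ; zero; suc; _+_; _*_; _∸_; _^_; _⊔_; _≤_; _<_; z≤n; s≤s; _≤?_; _<?_; _≟_; ∣_-_∣; NonZero)
open import Data.Nat.Properties
open import Data.Nat.DivMod using (_/_; _%_; _mod_; m≡m%n+[m/n]*n; m%n<n; m<n⇒m%n≡m; /-monoˡ-≤; +-distrib-/-∣ʳ; m*n/n≡m)
open import Data.Nat.Divisibility
open import Data.Nat.Logarithm using (⌊log₂_⌋; ⌈log₂_⌉; ⌊log₂[2^n]⌋≡n; ⌈log₂2^n⌉≡n; ⌈log₂⌉-mono-≤)
open import Data.Nat.Tactic.RingSolver using (solve-∀)
open import Data.Product using (Σ; ∃; ∃-syntax; _×_; _,_)
open import Data.Sum using (_⊎_; inj₁; inj₂; [_,_]′)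
open import Data.Bool using (true; false; _∨_; _∧_; if_then_else_)
open import Data.Fin using (Fin; toℕ; fromℕ<; splitAt; _↑ˡ_; _↑ʳ_; combine)
import Data.Fin as Fin
import Data.Fin.Properties as Fin
open import Data.List using (List; []; _∷_; _++_; length; filter; drop; upTo; map)
open import Data.List.Properties using (filter-accept; filter-reject; drop-all; length-upTo)
open import Data.List.Membership.Propositional using (_∈_; _∉_)
open import Data.List.Membership.Propositional.Properties using (∈-upTo⁺; ∈-upTo⁻; ∈-map⁺; ∈-++⁺ˡ; ∈-++⁺ʳ)
open import Data.List.Relation.Unary.Any using (here; there)
open import Data.List.Relation.Unary.All using (lookup)
open import Data.List.Relation.Unary.AllPairs using (AllPairs; []; _∷_)
open import Data.List.Relation.Unary.Unique.Propositional using (Unique)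
open import Data.List.Relation.Unary.Unique.Propositional.Properties using (upTo⁺)
open import Data.List.Relation.Unary.Sorted.TotalOrder.Properties using (Sorted⇒AllPairs)
open import Data.List.Relation.Binary.Permutation.Propositional using (_↭_; ↭-sym; ↭⇒↭ₛ)
open import Data.List.Relation.Binary.Permutation.Propositional.Properties using (∈-resp-↭; ↭-length)
import Data.List.Relation.Binary.Permutation.Setoid.Properties as PermSetoid
import Data.List.Sort as Sort
import Relation.Binary.Construct.On as On
open import Function using (_∘_; mk⇔)
open import Function.Bundles using (Inverse)
open import Function.Construct.Identity using (↔-id)
open import Relation.Nullary using (¬_; Dec; yes; no; contradiction; does)
open import Relation.Nullary.Decidable using (⌊_⌋; _×-dec_; _⊎-dec_; dec-true; dec-false; does-⇔)
open import Relation.Unary using (Pred; Decidable)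
open import Relation.Binary.Bundles using (DecTotalOrder)
open import Relation.Binary.Definitions using (Tri; tri<; tri≈; tri>)
open import Relation.Binary.PropositionalEquality
  using (_≡_; _≢_; refl; trans; cong; cong₂; subst; setoid; module ≡-Reasoning) renaming (sym to ≡-sym)

-- Clique-width and crossing path systems

module _ {k : ℕ} (e₁ e₂ : Expr k) where

  label-ˡ : ∀ a → label (e₁ ⊕ e₂) (a ↑ˡ size e₂) ≡ label e₁ a
  label-ˡ a rewrite Fin.splitAt-↑ˡ (size e₁) a (size e₂) = refl

  label-ʳ : ∀ a → label (e₁ ⊕ e₂) (size e₁ ↑ʳ a) ≡ label e₂ a
  label-ʳ a rewrite Fin.splitAt-↑ʳ (size e₁) (size e₂) a = refl

  eadj-ˡˡ : ∀ a b → eadj (e₁ ⊕ e₂) (a ↑ˡ size e₂) (b ↑ˡ size e₂) ≡ eadj e₁ a b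
  eadj-ˡˡ a b rewrite Fin.splitAt-↑ˡ (size e₁) a (size e₂) | Fin.splitAt-↑ˡ (size e₁) b (size e₂) = refl

  eadj-ˡʳ : ∀ a b → eadj (e₁ ⊕ e₂) (a ↑ˡ size e₂) (size e₁ ↑ʳ b) ≡ false
  eadj-ˡʳ a b rewrite Fin.splitAt-↑ˡ (size e₁) a (size e₂) | Fin.splitAt-↑ʳ (size e₁) (size e₂) b = refl

  eadj-ʳˡ : ∀ a b → eadj (e₁ ⊕ e₂) (size e₁ ↑ʳ a) (b ↑ˡ size e₂) ≡ false
  eadj-ʳˡ a b rewrite Fin.splitAt-↑ˡ (size e₁) b (size e₂) | Fin.splitAt-↑ʳ (size e₁) (size e₂) a = refl

  eadj-ʳʳ : ∀ a b → eadj (e₁ ⊕ e₂) (size e₁ ↑ʳ a) (size e₁ ↑ʳ b) ≡ eadj e₂ a b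
  eadj-ʳʳ a b rewrite Fin.splitAt-↑ʳ (size e₁) (size e₂) a | Fin.splitAt-↑ʳ (size e₁) (size e₂) b = refl

module _ {p} {P : Pred ℕ p} (P? : Decidable P) where

  all≤? : ∀ ℓ → Dec (∀ x → x ≤ ℓ → P x)
  all≤? ℓ with allUpTo? P? (suc ℓ)
  ... | yes h = yes λ x x≤ℓ → h (s≤s x≤ℓ)
  ... | no ¬h = no λ h → ¬h λ { (s≤s x≤ℓ) → h _ x≤ℓ }

  -- A discrete intermediate value argument. If `P` agrees at the last two points, then the missing
  -- witness lies further left: a failure when both hold, `x` when both fail. The change may go
  -- either way, since a path can enter or leave a set.
  boundary : ∀ ℓ x → x ≤ ℓ → P x → ¬ (∀ y → y ≤ ℓ → P y) →
             ∃[ z ] z < ℓ × ((P z × ¬ P (suc z)) ⊎ (P (suc z) × ¬ P z))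
  boundary zero .zero z≤n Px ¬all = contradiction (λ { .zero z≤n → Px }) ¬all
  boundary (suc ℓ) x x≤sℓ Px ¬all with P? ℓ | P? (suc ℓ)
  ... | yes a | no b  = ℓ , ≤-refl , inj₁ (a , b)
  ... | no a  | yes b = ℓ , ≤-refl , inj₂ (b , a)
  ... | yes a | yes b
    with boundary ℓ ℓ ≤-refl a (λ h → ¬all λ y y≤ → [ h y ∘ ≤-pred , (λ { refl → b }) ]′ (m≤n⇒m<n∨m≡n y≤))
  ...   | z , z<ℓ , cut = z , m<n⇒m<1+n z<ℓ , cut
  boundary (suc ℓ) x x≤sℓ Px ¬all | no a | no b with m≤n⇒m<n∨m≡n x≤sℓ
  ... | inj₂ refl = contradiction Px b
  ... | inj₁ (s≤s x≤ℓ) with boundary ℓ x x≤ℓ Px (λ h → a (h ℓ ≤-refl))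
  ...   | z , z<ℓ , cut = z , m<n⇒m<1+n z<ℓ , cut

module _ (G : Graph) where

  -- Path `c` consists of `vert c 0` up to `vert c (len c)` inclusive; `vert` is total for
  -- convenience and unconstrained further on.
  record PathSystem (m : ℕ) : Set where
    field
      len       : Fin m → ℕ
      vert      : Fin m → ℕ → Fin (n G)
      nonempty  : ∀ c → 0 < len c
      edge      : ∀ c x → x < len c → adj G (vert c x) (vert c (suc x)) ≡ true

    Step : Fin m → Fin (n G) → Fin (n G) → Set
    Step c u w = ∃[ x ] x < len c ×
      ((u ≡ vert c x × w ≡ vert c (suc x)) ⊎ (u ≡ vert c (suc x) × w ≡ vert c x))

    field
      -- If the edges u w and u′ w′ leave a subexpression containing u and u′ with equal labels,
      -- then both cross pairs are edges as well.
      separated : ∀ {c c′ u w u′ w′} → Step c u w → Step c′ u′ w′ →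
                  adj G u w′ ≡ true → adj G u′ w ≡ true → c ≡ c′

    step-adj : ∀ {c u w} → Step c u w → adj G u w ≡ true
    step-adj (x , x<ℓ , inj₁ (refl , refl)) = edge _ x x<ℓ
    step-adj (x , x<ℓ , inj₂ (refl , refl)) = trans (Graph.sym G _ _) (edge _ x x<ℓ)

    FullIn : (Fin (n G) → Set) → Fin m → Set
    FullIn A c = ∀ x → x ≤ len c → A (vert c x)

    fullIn? : ∀ {A} → Decidable A → Dec (∃ (FullIn A))
    fullIn? A? = Fin.any? λ c → all≤? (A? ∘ vert c) (len c)

  open PathSystem

  Image : ∀ {s} → (Fin s → Fin (n G)) → Fin (n G) → Set
  Image ι v = ∃[ a ] ι a ≡ v

  image? : ∀ {s} (ι : Fin s → Fin (n G)) → Decidable (Image ι)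
  image? ι v = Fin.any? λ a → ι a Fin.≟ v

  -- What a subexpression e of an expression for G knows about G, its vertices being placed
  -- in G by ι: the rest of the expression sees a vertex of e only through its label.
  record Uniform {k} (e : Expr k) (ι : Fin (size e) → Fin (n G)) : Set where
    field
      outside : ∀ {a b w} → label e a ≡ label e b → ¬ Image ι w →
                adj G (ι a) w ≡ adj G (ι b) w
      inside  : ∀ {a b c} → label e a ≡ label e b → eadj e a c ≡ eadj e b c →
                adj G (ι a) (ι c) ≡ adj G (ι b) (ι c)

  open Uniform

  module _ {k : ℕ} where

    -- A join keeps labels, and the edges it adds depend on labels alone, so agreement before the
    -- join persists after it.
    uniform-join : ∀ {i j i≢j} {e : Expr k} {ι} → Uniform (join i j i≢j e) ι → Uniform e ι
    uniform-join U .outside = outside U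
    uniform-join {i} {j} {e = e} U .inside {c = c} l q = inside U l
      (cong₂ (λ b x → b ∨ (⌊ x Fin.≟ i ⌋ ∧ ⌊ label e c Fin.≟ j ⌋) ∨ (⌊ x Fin.≟ j ⌋ ∧ ⌊ label e c Fin.≟ i ⌋)) q l)

    uniform-relab : ∀ {i j} {e : Expr k} {ι} → Uniform (relab i j e) ι → Uniform e ι
    uniform-relab {i} {j} U .outside l = outside U (cong (λ x → if ⌊ x Fin.≟ i ⌋ then j else x) l)
    uniform-relab {i} {j} U .inside l = inside U (cong (λ x → if ⌊ x Fin.≟ i ⌋ then j else x) l)

    module _ {e₁ e₂ : Expr k} {ι : Fin (size (e₁ ⊕ e₂)) → Fin (n G)} where

      ιˡ : Fin (size e₁) → Fin (n G)
      ιˡ = ι ∘ (_↑ˡ size e₂)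

      ιʳ : Fin (size e₂) → Fin (n G)
      ιʳ = ι ∘ (size e₁ ↑ʳ_)

      image-⊕ : ∀ {v} → Image ι v → Image ιˡ v ⊎ Image ιʳ v
      image-⊕ (a , ιa≡v) with splitAt (size e₁) a in eq
      ... | inj₁ b = inj₁ (b , trans (cong ι (Fin.splitAt⁻¹-↑ˡ eq)) ιa≡v)
      ... | inj₂ b = inj₂ (b , trans (cong ι (Fin.splitAt⁻¹-↑ʳ eq)) ιa≡v)

      module _ (U : Uniform (e₁ ⊕ e₂) ι) where

        private
          labˡ : ∀ {a b} → label e₁ a ≡ label e₁ b →
                 label (e₁ ⊕ e₂) (a ↑ˡ size e₂) ≡ label (e₁ ⊕ e₂) (b ↑ˡ size e₂)
          labˡ {a} {b} l = trans (label-ˡ e₁ e₂ a) (trans l (≡-sym (label-ˡ e₁ e₂ b)))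

          labʳ : ∀ {a b} → label e₂ a ≡ label e₂ b →
                 label (e₁ ⊕ e₂) (size e₁ ↑ʳ a) ≡ label (e₁ ⊕ e₂) (size e₁ ↑ʳ b)
          labʳ {a} {b} l = trans (label-ʳ e₁ e₂ a) (trans l (≡-sym (label-ʳ e₁ e₂ b)))

        uniform-⊕ˡ : Uniform e₁ ιˡ
        uniform-⊕ˡ .outside {a} {b} {w} l w∉ with image? ι w
        ... | no w∉ι = outside U (labˡ l) w∉ι
        ... | yes w∈ with image-⊕ w∈
        ...   | inj₁ w∈ˡ = contradiction w∈ˡ w∉
        -- A vertex of the other half has as yet no edge to this half, so both adjacencies are
        -- `false` and `inside` of the union applies.
        ...   | inj₂ (c , refl) = inside U (labˡ l) (trans (eadj-ˡʳ e₁ e₂ a c) (≡-sym (eadj-ˡʳ e₁ e₂ b c)))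
        uniform-⊕ˡ .inside {a} {b} {c} l q =
          inside U (labˡ l) (trans (eadj-ˡˡ e₁ e₂ a c) (trans q (≡-sym (eadj-ˡˡ e₁ e₂ b c))))

        uniform-⊕ʳ : Uniform e₂ ιʳ
        uniform-⊕ʳ .outside {a} {b} {w} l w∉ with image? ι w
        ... | no w∉ι = outside U (labʳ l) w∉ι
        ... | yes w∈ with image-⊕ w∈
        ...   | inj₂ w∈ʳ = contradiction w∈ʳ w∉
        ...   | inj₁ (c , refl) = inside U (labʳ l) (trans (eadj-ʳˡ e₁ e₂ a c) (≡-sym (eadj-ʳˡ e₁ e₂ b c)))
        uniform-⊕ʳ .inside {a} {b} {c} l q =
          inside U (labʳ l) (trans (eadj-ʳʳ e₁ e₂ a c) (trans q (≡-sym (eadj-ʳʳ e₁ e₂ b c))))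

    module _ {m : ℕ} (𝒫 : PathSystem m) where

      record CutPath {e : Expr k} (ι : Fin (size e) → Fin (n G)) (c : Fin m) : Set where
        constructor cutPath
        field
          inner : Fin (size e)
          outer : Fin (n G)
          step  : Step 𝒫 c (ι inner) outer
          avoid : ¬ Image ι outer

      cut : ∀ {e : Expr k} {ι : Fin (size e) → Fin (n G)} c x → x ≤ len 𝒫 c →
            Image ι (vert 𝒫 c x) → ¬ FullIn 𝒫 (Image ι) c → CutPath {e} ι c
      cut {ι = ι} c x x≤ v∈ ¬full with boundary (image? ι ∘ vert 𝒫 c) (len 𝒫 c) x x≤ v∈ ¬full
      ... | z , z< , inj₁ ((a , a≡) , ∉) = cutPath a _ (z , z< , inj₁ (a≡ , refl)) ∉
      ... | z , z< , inj₂ ((a , a≡) , ∉) = cutPath a _ (z , z< , inj₂ (a≡ , refl)) ∉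

      cutLabel : ∀ {e : Expr k} {ι c} → CutPath {e} ι c → Fin k
      cutLabel {e} p = label e (CutPath.inner p)

      -- Both outer ends lie outside the subexpression, so inner ends with equal labels have the
      -- same adjacency to each of them. This yields both cross edges required by `separated`.
      cut-separates : ∀ {e : Expr k} {ι} → Uniform e ι → ∀ {c c′} (p : CutPath {e} ι c) (p′ : CutPath {e} ι c′) →
                      cutLabel p ≡ cutLabel p′ → c ≡ c′
      cut-separates U (cutPath a w s ∉) (cutPath a′ w′ s′ ∉′) l =
        separated 𝒫 s s′ (trans (outside U l ∉′) (step-adj 𝒫 s′))
                         (trans (outside U (≡-sym l) ∉) (step-adj 𝒫 s))

      module _ {e₁ e₂ : Expr k} {ι : Fin (size (e₁ ⊕ e₂)) → Fin (n G)} (U : Uniform (e₁ ⊕ e₂) ι)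
               (¬fullˡ : ¬ ∃ (FullIn 𝒫 (Image (ιˡ {e₁} {e₂} {ι}))))
               (¬fullʳ : ¬ ∃ (FullIn 𝒫 (Image (ιʳ {e₁} {e₂} {ι}))))
               (meets : ∀ c → ∃[ x ] x ≤ len 𝒫 c × Image ι (vert 𝒫 c x)) where

        private
          SideCut : Fin m → Set
          SideCut c = CutPath {e₁} (ιˡ {e₁} {e₂} {ι}) c ⊎ CutPath {e₂} (ιʳ {e₁} {e₂} {ι}) c

          sideCut : ∀ c → SideCut c
          sideCut c with meets c
          ... | x , x≤ , v∈ with image-⊕ {e₁} {e₂} {ι} v∈
          ...   | inj₁ v∈ˡ = inj₁ (cut {e₁} c x x≤ v∈ˡ λ f → ¬fullˡ (c , f))
          ...   | inj₂ v∈ʳ = inj₂ (cut {e₂} c x x≤ v∈ʳ λ f → ¬fullʳ (c , f))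

          code : ∀ {c} → SideCut c → Fin (2 * k)
          code (inj₁ p) = combine {2} Fin.zero (cutLabel p)
          code (inj₂ p) = combine {2} (Fin.suc Fin.zero) (cutLabel p)

          code-separates : ∀ {c c′} (p : SideCut c) (p′ : SideCut c′) → code p ≡ code p′ → c ≡ c′
          code-separates (inj₁ p) (inj₁ p′) q =
            cut-separates (uniform-⊕ˡ U) p p′ (Fin.combine-injectiveʳ {2} Fin.zero _ Fin.zero _ q)
          code-separates (inj₂ p) (inj₂ p′) q =
            cut-separates (uniform-⊕ʳ U) p p′ (Fin.combine-injectiveʳ {2} (Fin.suc Fin.zero) _ (Fin.suc Fin.zero) _ q)
          code-separates (inj₁ p) (inj₂ p′) q
            with () ← Fin.combine-injectiveˡ {2} Fin.zero (cutLabel p) (Fin.suc Fin.zero) (cutLabel p′) q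
          code-separates (inj₂ p) (inj₁ p′) q
            with () ← Fin.combine-injectiveˡ {2} (Fin.suc Fin.zero) (cutLabel p) Fin.zero (cutLabel p′) q

        -- Every path meets some half without lying inside it, hence has an edge leaving that half.
        -- The half together with the label of the inner end determines the path, and there are only
        -- `2 * k` such pairs.
        many-labels : m ≤ 2 * k
        many-labels with m ≤? 2 * k
        ... | yes m≤ = m≤
        ... | no m≰ with Fin.pigeonhole (≰⇒> m≰) (code ∘ sideCut)
        ...   | c , c′ , c<c′ , q =
          contradiction (cong toℕ (code-separates (sideCut c) (sideCut c′) q)) (<⇒≢ c<c′)

    path-distinct : ∀ {m} (𝒫 : PathSystem m) c → vert 𝒫 c 0 ≢ vert 𝒫 c 1
    path-distinct 𝒫 c q with () ← trans (≡-sym (edge 𝒫 c 0 (nonempty 𝒫 c)))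
      (trans (cong (λ v → adj G v (vert 𝒫 c 1)) q) (irrefl G _))

    not-full-vtx : ∀ {m} (𝒫 : PathSystem m) {i : Fin k} (ι : Fin (size (vtx i)) → Fin (n G)) →
                   ¬ ∃ (FullIn 𝒫 (Image ι))
    not-full-vtx 𝒫 ι (c , full) with full 0 z≤n | full 1 (nonempty 𝒫 c)
    ... | Fin.zero , q | Fin.zero , q′ = path-distinct 𝒫 c (trans (≡-sym q) q′)

    module _ {m : ℕ} (ℛ 𝒞 : PathSystem m)
             (crossing : ∀ r c → ∃[ x ] ∃[ y ] x ≤ len ℛ r × y ≤ len 𝒞 c × vert ℛ r x ≡ vert 𝒞 c y) where

      -- The recursion enters a half as long as that half contains a line. Where it stops, a full
      -- line meets all lines of the other kind by `crossing`, and these are the ones counted. It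
      -- cannot reach a single vertex, because every path has an edge.
      grid-descent : (e : Expr k) (ι : Fin (size e) → Fin (n G)) → Uniform e ι →
                     ∃ (FullIn ℛ (Image ι)) ⊎ ∃ (FullIn 𝒞 (Image ι)) → m ≤ 2 * k
      grid-descent (vtx i) ι U (inj₁ f) = contradiction f (not-full-vtx ℛ {i} ι)
      grid-descent (vtx i) ι U (inj₂ f) = contradiction f (not-full-vtx 𝒞 {i} ι)
      grid-descent (join i j i≢j e) ι U f = grid-descent e ι (uniform-join U) f
      grid-descent (relab i j e) ι U f = grid-descent e ι (uniform-relab U) f
      grid-descent (e₁ ⊕ e₂) ι U f
        with fullIn? ℛ (image? (ιˡ {e₁} {e₂} {ι})) | fullIn? 𝒞 (image? (ιˡ {e₁} {e₂} {ι}))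
           | fullIn? ℛ (image? (ιʳ {e₁} {e₂} {ι})) | fullIn? 𝒞 (image? (ιʳ {e₁} {e₂} {ι}))
      ... | yes g | _ | _ | _ = grid-descent e₁ _ (uniform-⊕ˡ U) (inj₁ g)
      ... | _ | yes g | _ | _ = grid-descent e₁ _ (uniform-⊕ˡ U) (inj₂ g)
      ... | _ | _ | yes g | _ = grid-descent e₂ _ (uniform-⊕ʳ U) (inj₁ g)
      ... | _ | _ | _ | yes g = grid-descent e₂ _ (uniform-⊕ʳ U) (inj₂ g)
      ... | no rˡ | no cˡ | no rʳ | no cʳ = meet f
        where
        meet : ∃ (FullIn ℛ (Image ι)) ⊎ ∃ (FullIn 𝒞 (Image ι)) → m ≤ 2 * k
        meet (inj₁ (r , full)) = many-labels 𝒞 U cˡ cʳ λ c →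
          let x , y , x≤ , y≤ , q = crossing r c in y , y≤ , subst (Image ι) q (full x x≤)
        meet (inj₂ (c , full)) = many-labels ℛ U rˡ rʳ λ r →
          let x , y , x≤ , y≤ , q = crossing r c in x , x≤ , subst (Image ι) (≡-sym q) (full y y≤)

      -- For the whole expression nothing is outside, and `eadj` is the adjacency of `G`, so
      -- uniformity is immediate. The given index supplies a full row to start from.
      cw-grid : Fin m → Cw≤ G k → m ≤ 2 * k
      cw-grid r (e , φ , φ-adj) = grid-descent e from uniform (inj₁ (r , λ x _ → to (vert ℛ r x) , strictlyInverseʳ _))
        where
        open Inverse φ using (to; from; strictlyInverseˡ; strictlyInverseʳ)
        from-adj : ∀ a b → adj G (from a) (from b) ≡ eadj e a b
        from-adj a b = trans (φ-adj _ _) (cong₂ (eadj e) (strictlyInverseˡ a) (strictlyInverseˡ b))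
        uniform : Uniform e from
        uniform .outside {w = w} _ w∉ = contradiction (to w , strictlyInverseʳ w) w∉
        uniform .inside {a} {b} {c} _ q = trans (from-adj a c) (trans q (≡-sym (from-adj b c)))

-- The dyadic graphs contain large grids

2^-mono : ∀ {i j} → i ≤ j → 2 ^ i ≤ 2 ^ j
2^-mono = ^-monoʳ-≤ 2

2^-mono-< : ∀ {i j} → i < j → 2 ^ i < 2 ^ j
2^-mono-< = ^-monoʳ-< 2 (s≤s (s≤s z≤n))

2^-cancel-≤ : ∀ {i j} → 2 ^ i ≤ 2 ^ j → i ≤ j
2^-cancel-≤ {i} {j} le = ≮⇒≥ λ j<i → <⇒≱ (2^-mono-< j<i) le

2^-∣ : ∀ {i j} → i ≤ j → 2 ^ i ∣ 2 ^ j
2^-∣ {i} {j} i≤j = subst (2 ^ i ∣_) (trans (≡-sym (^-distribˡ-+-* 2 i (j ∸ i))) (cong (2 ^_) (m+[n∸m]≡n i≤j)))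
                     (m∣m*n (2 ^ (j ∸ i)))

suc-n≤2^n : ∀ n → suc n ≤ 2 ^ n
suc-n≤2^n zero = ≤-refl
suc-n≤2^n (suc n) = begin
  1 + suc n         ≤⟨ +-mono-≤ (m^n>0 2 n) (suc-n≤2^n n) ⟩
  2 ^ n + 2 ^ n     ≡⟨ cong (2 ^ n +_) (+-identityʳ (2 ^ n)) ⟨
  2 ^ suc n         ∎
  where open ≤-Reasoning

∣-∣-path : ∀ a b c d → ∣ a - d ∣ ≤ ∣ a - b ∣ + (∣ b - c ∣ + ∣ c - d ∣)
∣-∣-path a b c d = ≤-trans (∣-∣-triangle a b d) (+-monoʳ-≤ _ (∣-∣-triangle b c d))

-- Doubling the endpoints expresses divisibility by half the edge length without a predecessor at
-- exponent 0. The bound on the exponent makes the search in `adjacent?` finite.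
record Adjacent (K p q : ℕ) : Set where
  constructor adjacent
  field
    {exponent} : ℕ
    exponent<  : exponent < K
    distance   : ∣ p - q ∣ ≡ 2 ^ exponent
    divides-p  : 2 ^ exponent ∣ 2 * p
    divides-q  : 2 ^ exponent ∣ 2 * q

adjacent? : ∀ K p q → Dec (Adjacent K p q)
adjacent? K p q with anyUpTo? (λ j → (∣ p - q ∣ ≟ 2 ^ j) ×-dec (2 ^ j ∣? 2 * p) ×-dec (2 ^ j ∣? 2 * q)) K
... | yes (j , j<K , d , dp , dq) = yes (adjacent j<K d dp dq)
... | no ¬a = no λ { (adjacent j<K d dp dq) → ¬a (_ , j<K , d , dp , dq) }

adjacent-sym : ∀ {K p q} → Adjacent K p q → Adjacent K q p
adjacent-sym {K} {p} {q} (adjacent j<K d dp dq) = adjacent j<K (trans (∣-∣-comm q p) d) dq dp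

dyadic : ℕ → Graph
dyadic K .n = 2 ^ K
dyadic K .adj u v = does (adjacent? K (toℕ u) (toℕ v))
dyadic K .Graph.sym u v = does-⇔ (mk⇔ adjacent-sym adjacent-sym) (adjacent? K _ _) (adjacent? K _ _)
dyadic K .irrefl u = dec-false (adjacent? K _ _) λ { (adjacent {j} _ d _ _) →
  <⇒≢ (m^n>0 2 j) (trans (≡-sym (m≡n⇒∣m-n∣≡0 {toℕ u} refl)) d) }

module _ (K : ℕ) where

  adj⇒adjacent : ∀ {u v} → adj (dyadic K) u v ≡ true → Adjacent K (toℕ u) (toℕ v)
  adj⇒adjacent {u} {v} h with yes a ← adjacent? K (toℕ u) (toℕ v) = a

  adjacent⇒adj : ∀ {u v} → Adjacent K (toℕ u) (toℕ v) → adj (dyadic K) u v ≡ true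
  adjacent⇒adj = dec-true (adjacent? K _ _)

  vertex : ℕ → Fin (2 ^ K)
  vertex p = _mod_ p (2 ^ K) {{m^n≢0 2 K}}

  toℕ-vertex : ∀ {p} → p < 2 ^ K → toℕ (vertex p) ≡ p
  toℕ-vertex p< = trans (Fin.toℕ-fromℕ< _) (m<n⇒m%n≡m {{m^n≢0 2 K}} p<)

-- This is (2x + 1) 2^h, so `node h` enumerates the numbers of 2-adic valuation exactly `h`.
node : ℕ → ℕ → ℕ
node h x = 2 ^ h + x * 2 ^ suc h

-- Twice a node is an odd multiple of 2^(h+1). Hence no edge at a vertex of valuation `h` is longer
-- than 2^(h+1).
∣2*node⇒≤ : ∀ {h j} x → 2 ^ j ∣ 2 * node h x → j ≤ suc h
∣2*node⇒≤ {h} {j} x div with j ≤? suc h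
... | yes j≤ = j≤
... | no j≰ = contradiction (∣⇒≤ {{m^n≢0 2 (suc h)}} (∣m+n∣m⇒∣n div′ (n∣m*n x {2 ^ suc (suc h)})))
                (<⇒≱ (2^-mono-< (n<1+n (suc h))))
  where
  rearrange : ∀ a b → 2 * (a + b * (2 * a)) ≡ b * (2 * (2 * a)) + 2 * a
  rearrange = solve-∀
  div′ : 2 ^ suc (suc h) ∣ x * 2 ^ suc (suc h) + 2 ^ suc h
  div′ = subst (2 ^ suc (suc h) ∣_) (rearrange (2 ^ h) x) (∣-trans (2^-∣ (≰⇒> j≰)) div)

2^∣2*node : ∀ {h} x → 2 ^ suc h ∣ 2 * node h x
2^∣2*node {h} x = *-monoʳ-∣ 2 (∣m∣n⇒∣m+n {2 ^ h} ∣-refl (∣n⇒∣m*n x (n∣m*n 2 {2 ^ h})))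

∣d+a-a∣ : ∀ d a → ∣ d + a - a ∣ ≡ d
∣d+a-a∣ d a = trans (∣-∣-comm (d + a) a) (trans (cong (∣ a -_∣) (+-comm d a)) (∣m-m+n∣≡n a d))

node-suc : ∀ h x → ∣ node h x - node h (suc x) ∣ ≡ 2 ^ suc h
node-suc h x = trans (∣m+n-m+o∣≡∣n-o∣ (2 ^ h) _ _)
  (trans (∣-∣-comm (x * 2 ^ suc h) _) (∣d+a-a∣ (2 ^ suc h) (x * 2 ^ suc h)))

module Grid (m : ℕ) where

  -- Columns are spaced 2^B apart; `B` is just large enough for the estimate 2^(2m+2) < 2^B in
  -- `cols-apart`. `K` leaves room for `m + 1` blocks of that width, as m + 1 ≤ 2^m.
  B K : ℕ
  B = suc (suc (suc (2 * m)))
  K = m + B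

  -- The index at which column `c` crosses the numbers of valuation `h`: the exponent is B - (h +
  -- 1), which turns `node h (offset c h)` into 2^h + c 2^B.
  offset : ℕ → ℕ → ℕ
  offset c h = c * 2 ^ (suc (suc (2 * m)) ∸ h)

  offset-scale : ∀ c {h} → h ≤ 2 * m → offset c h * 2 ^ suc h ≡ c * 2 ^ B
  offset-scale c {h} h≤ = begin
    c * 2 ^ (2+2m ∸ h) * 2 ^ suc h    ≡⟨ *-assoc c _ _ ⟩
    c * (2 ^ (2+2m ∸ h) * 2 ^ suc h)  ≡⟨ cong (c *_) (^-distribˡ-+-* 2 (2+2m ∸ h) (suc h)) ⟨
    c * 2 ^ ((2+2m ∸ h) + suc h)      ≡⟨ cong (λ z → c * 2 ^ z) (m∸n+n≡m {B} {suc h} (s≤s (m≤n⇒m≤1+n (m≤n⇒m≤1+n h≤)))) ⟩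
    c * 2 ^ B                         ∎
    where open ≡-Reasoning ; 2+2m = suc (suc (2 * m))

  node-offset : ∀ c {h} → h ≤ 2 * m → node h (offset c h) ≡ 2 ^ h + c * 2 ^ B
  node-offset c {h} h≤ = cong (2 ^ h +_) (offset-scale c h≤)

  node<2^K : ∀ {h x} → h ≤ 2 * m → x ≤ offset m h → node h x < 2 ^ K
  node<2^K {h} {x} h≤ x≤ = begin-strict
    2 ^ h + x * 2 ^ suc h            ≤⟨ +-monoʳ-≤ (2 ^ h) (*-monoˡ-≤ (2 ^ suc h) x≤) ⟩
    2 ^ h + offset m h * 2 ^ suc h   ≡⟨ node-offset m h≤ ⟩
    2 ^ h + m * 2 ^ B                <⟨ +-monoˡ-< (m * 2 ^ B) (2^-mono-< (s≤s (m≤n⇒m≤1+n (m≤n⇒m≤1+n h≤)))) ⟩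
    suc m * 2 ^ B                    ≤⟨ *-monoˡ-≤ (2 ^ B) (suc-n≤2^n m) ⟩
    2 ^ m * 2 ^ B                    ≡⟨ ^-distribˡ-+-* 2 m B ⟨
    2 ^ K                            ∎
    where open ≤-Reasoning

  IsNode : ℕ → ℕ → Fin (2 ^ K) → Set
  IsNode h x u = toℕ u ≡ node h x

  isNode : ∀ {h} x → h ≤ 2 * m → x ≤ offset m h → IsNode h x (vertex K (node h x))
  isNode {h} x h≤ x≤ = toℕ-vertex K (node<2^K {h} {x} h≤ x≤)

  adj-distance : ∀ h x {u v} → IsNode h x u → adj (dyadic K) u v ≡ true → ∣ toℕ u - toℕ v ∣ ≤ 2 ^ suc h
  adj-distance h x nu a with adj⇒adjacent K a
  ... | adjacent {j} _ d du _ = ≤-trans (≤-reflexive d) (2^-mono {j} (∣2*node⇒≤ {h} {j} x (subst (λ z → 2 ^ j ∣ 2 * z) nu du)))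

  2r≤2m : (r : Fin m) → 2 * toℕ r ≤ 2 * m
  2r≤2m r = *-monoʳ-≤ 2 (<⇒≤ (Fin.toℕ<n r))

  -- Rows run one column spacing beyond the last column `m - 1`, so that they have an edge even for
  -- `m = 1`.
  rowLen : Fin m → ℕ
  rowLen r = offset m (2 * toℕ r)

  -- Only even valuations serve as rows. An edge of a higher row would be bridged by three steps no
  -- longer than an edge of the lower row; a length ratio of 4 excludes this, a ratio of 2 would
  -- not.
  row : Fin m → ℕ → Fin (2 ^ K)
  row r x = vertex K (node (2 * toℕ r) x)

  record RowStep (r : Fin m) (u w : Fin (2 ^ K)) : Set where
    field
      {posᵤ posʷ} : ℕ
      nodeᵤ       : IsNode (2 * toℕ r) posᵤ u
      nodeʷ       : IsNode (2 * toℕ r) posʷ w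
      distance    : ∣ toℕ u - toℕ w ∣ ≡ 2 ^ suc (2 * toℕ r)

  row-edge : ∀ r x → x < rowLen r → RowStep r (row r x) (row r (suc x))
  row-edge r x x< = record
    { posᵤ = x ; posʷ = suc x ; nodeᵤ = nᵤ ; nodeʷ = nʷ ; distance = trans (cong₂ ∣_-_∣ nᵤ nʷ) (node-suc (2 * toℕ r) x) }
    where
    nᵤ = isNode x (2r≤2m r) (<⇒≤ x<)
    nʷ = isNode (suc x) (2r≤2m r) x<

  open PathSystem

  -- Edges of rows r < r′ have lengths differing by a factor of at least 4, whereas the
  -- cross edges are no longer than those of row r.
  rows-apart : ∀ {r r′ u w u′ w′} → RowStep r u w → RowStep r′ u′ w′ →
               adj (dyadic K) u w′ ≡ true → adj (dyadic K) u′ w ≡ true → ¬ (toℕ r < toℕ r′)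
  rows-apart {r} {r′} {u} {w} {u′} {w′} s s′ uw′ u′w r<r′ = <-irrefl refl (begin-strict
    2 ^ suc h′                                          ≡⟨ RowStep.distance s′ ⟨
    ∣ toℕ u′ - toℕ w′ ∣                                 ≤⟨ ∣-∣-path (toℕ u′) (toℕ w) (toℕ u) (toℕ w′) ⟩
    ∣ toℕ u′ - toℕ w ∣ + (∣ toℕ w - toℕ u ∣ + ∣ toℕ u - toℕ w′ ∣)
      ≤⟨ +-mono-≤ u′w≤ (+-mono-≤ wu≤ (adj-distance h posᵤ nodeᵤ uw′)) ⟩
    2 ^ suc h + (2 ^ suc h + 2 ^ suc h)
      <⟨ +-monoʳ-< (2 ^ suc h) (+-monoʳ-< (2 ^ suc h) (m<m+n (2 ^ suc h) (m^n>0 2 (suc h)))) ⟩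
    2 ^ suc h + (2 ^ suc h + (2 ^ suc h + 2 ^ suc h))   ≡⟨ rearrange (2 ^ suc h) ⟩
    2 ^ suc (suc (suc h))                               ≤⟨ 2^-mono (s≤s (subst (_≤ h′) (*-suc 2 (toℕ r)) (*-monoʳ-≤ 2 r<r′))) ⟩
    2 ^ suc h′                                          ∎)
    where
    open ≤-Reasoning
    open RowStep s using (posᵤ; posʷ; nodeᵤ; nodeʷ; distance)
    h = 2 * toℕ r
    h′ = 2 * toℕ r′
    u′w≤ : ∣ toℕ u′ - toℕ w ∣ ≤ 2 ^ suc h
    u′w≤ = subst (_≤ 2 ^ suc h) (∣-∣-comm (toℕ w) (toℕ u′))
             (adj-distance h posʷ nodeʷ (trans (Graph.sym (dyadic K) w u′) u′w))
    wu≤ : ∣ toℕ w - toℕ u ∣ ≤ 2 ^ suc h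
    wu≤ = ≤-reflexive (trans (∣-∣-comm (toℕ w) (toℕ u)) distance)
    rearrange : ∀ a → a + (a + (a + a)) ≡ 2 * (2 * a)
    rearrange = solve-∀

  -- This is `Step` of `rows`, written out because `rows` itself relies on it for `separated`.
  RowEdge : Fin m → Fin (2 ^ K) → Fin (2 ^ K) → Set
  RowEdge r u w = ∃[ x ] x < rowLen r ×
    ((u ≡ row r x × w ≡ row r (suc x)) ⊎ (u ≡ row r (suc x) × w ≡ row r x))

  rowStep : ∀ {r u w} → RowEdge r u w → RowStep r u w
  rowStep {r} (x , x< , inj₁ (refl , refl)) = row-edge r x x<
  rowStep {r} (x , x< , inj₂ (refl , refl)) = record
    { posᵤ = suc x ; posʷ = x ; nodeᵤ = nodeʷ ; nodeʷ = nodeᵤ ; distance = trans (∣-∣-comm (toℕ (row r (suc x))) _) distance }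
    where open RowStep (row-edge r x x<)

  rows : PathSystem (dyadic K) m
  rows .len = rowLen
  rows .vert = row
  rows .nonempty r = *-mono-≤ (≤-trans (s≤s z≤n) (Fin.toℕ<n r)) (m^n>0 2 (suc (suc (2 * m)) ∸ 2 * toℕ r))
  rows .edge r x x< = adjacent⇒adj K (adjacent (≤-trans (s≤s (s≤s (2r≤2m r))) (≤-trans (n≤1+n _) (m≤n+m B m))) distance
      (subst (λ z → 2 ^ suc (2 * toℕ r) ∣ 2 * z) (≡-sym nodeᵤ) (2^∣2*node {2 * toℕ r} x))
      (subst (λ z → 2 ^ suc (2 * toℕ r) ∣ 2 * z) (≡-sym nodeʷ) (2^∣2*node {2 * toℕ r} (suc x))))
    where open RowStep (row-edge r x x<)
  rows .separated {r} {r′} s s′ uw′ u′w = compare (<-cmp (toℕ r) (toℕ r′))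
    where
    compare : Tri (toℕ r < toℕ r′) (toℕ r ≡ toℕ r′) (toℕ r′ < toℕ r) → r ≡ r′
    compare (tri< r<r′ _ _) = contradiction r<r′ (rows-apart (rowStep s) (rowStep s′) uw′ u′w)
    compare (tri≈ _ r≡r′ _) = Fin.toℕ-injective r≡r′
    compare (tri> _ _ r′<r) = contradiction r′<r (rows-apart (rowStep s′) (rowStep s) u′w uw′)

  col : Fin m → ℕ → Fin (2 ^ K)
  col c h = vertex K (node h (offset (toℕ c) h))

  offset≤ : ∀ (c : Fin m) h → offset (toℕ c) h ≤ offset m h
  offset≤ c h = *-monoˡ-≤ _ (<⇒≤ (Fin.toℕ<n c))

  colNode : ∀ c {h} → h ≤ 2 * m → IsNode h (offset (toℕ c) h) (col c h)
  colNode c {h} h≤ = isNode (offset (toℕ c) h) h≤ (offset≤ c h)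

  toℕ-col : ∀ c {h} → h ≤ 2 * m → toℕ (col c h) ≡ 2 ^ h + toℕ c * 2 ^ B
  toℕ-col c h≤ = trans (colNode c h≤) (node-offset (toℕ c) h≤)

  col-distance : ∀ c h → h < 2 * m → ∣ toℕ (col c h) - toℕ (col c (suc h)) ∣ ≡ 2 ^ h
  col-distance c h h< = begin
    ∣ toℕ (col c h) - toℕ (col c (suc h)) ∣   ≡⟨ cong₂ ∣_-_∣ (toℕ-col c (<⇒≤ h<)) (toℕ-col c h<) ⟩
    ∣ 2 ^ h + b - 2 ^ suc h + b ∣             ≡⟨ cong (λ z → ∣ 2 ^ h + b - z ∣) (rearrange (2 ^ h) b) ⟩
    ∣ 2 ^ h + b - 2 ^ h + b + 2 ^ h ∣         ≡⟨ ∣m-m+n∣≡n (2 ^ h + b) (2 ^ h) ⟩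
    2 ^ h                                     ∎
    where
    open ≡-Reasoning
    b = toℕ c * 2 ^ B
    rearrange : ∀ a b → 2 * a + b ≡ a + b + a
    rearrange = solve-∀

  -- Each column vertex is within 2^(2m) of its anchor c 2^B, and the edge has length at most
  -- 2^(2m+1). The anchors are therefore at distance at most 2^(2m+2), less than the spacing 2^B of
  -- distinct anchors.
  cols-apart : ∀ {c c′ h h′} → h ≤ 2 * m → h′ ≤ 2 * m → adj (dyadic K) (col c h) (col c′ h′) ≡ true → c ≡ c′
  cols-apart {c} {c′} {h} {h′} h≤ h′≤ a with ∣ toℕ c - toℕ c′ ∣ in eq
  ... | zero = Fin.toℕ-injective (∣m-n∣≡0⇒m≡n eq)
  ... | suc d = contradiction (begin-strict
    2 ^ B                                       ≤⟨ m≤m+n (2 ^ B) (d * 2 ^ B) ⟩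
    suc d * 2 ^ B                               ≡⟨ cong (_* 2 ^ B) eq ⟨
    ∣ toℕ c - toℕ c′ ∣ * 2 ^ B                  ≡⟨ *-distribʳ-∣-∣ (2 ^ B) (toℕ c) (toℕ c′) ⟩
    ∣ b - b′ ∣                                  ≤⟨ ∣-∣-path b (2 ^ h + b) (2 ^ h′ + b′) b′ ⟩
    ∣ b - 2 ^ h + b ∣ + (∣ 2 ^ h + b - 2 ^ h′ + b′ ∣ + ∣ 2 ^ h′ + b′ - b′ ∣)
      ≡⟨ cong₂ _+_ (trans (∣-∣-comm b _) (∣d+a-a∣ (2 ^ h) b))
                   (cong₂ _+_ (≡-sym (cong₂ ∣_-_∣ (toℕ-col c h≤) (toℕ-col c′ h′≤))) (∣d+a-a∣ (2 ^ h′) b′)) ⟩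
    2 ^ h + (∣ toℕ (col c h) - toℕ (col c′ h′) ∣ + 2 ^ h′)
      ≤⟨ +-mono-≤ (2^-mono h≤)
           (+-mono-≤ (≤-trans (adj-distance h (offset (toℕ c) h) (colNode c h≤) a) (2^-mono (s≤s h≤))) (2^-mono h′≤)) ⟩
    2 ^ (2 * m) + (2 ^ suc (2 * m) + 2 ^ (2 * m))   ≡⟨ rearrange (2 ^ (2 * m)) ⟩
    2 ^ suc (suc (2 * m))                       <⟨ 2^-mono-< (n<1+n (suc (suc (2 * m)))) ⟩
    2 ^ B                                       ∎) (<-irrefl refl)
    where
    open ≤-Reasoning
    b = toℕ c * 2 ^ B
    b′ = toℕ c′ * 2 ^ B
    rearrange : ∀ a → a + (2 * a + a) ≡ 2 * (2 * a)
    rearrange = solve-∀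

  cols : PathSystem (dyadic K) m
  cols .len c = 2 * m
  cols .vert = col
  cols .nonempty c = *-mono-≤ (s≤s (z≤n {1})) (≤-trans (s≤s z≤n) (Fin.toℕ<n c))
  cols .edge c h h< = adjacent⇒adj K (adjacent (≤-trans h< (≤-trans (m≤n+m (2 * m) 3) (m≤n+m B m))) (col-distance c h h<)
    (subst (λ z → 2 ^ h ∣ 2 * z) (≡-sym (colNode c (<⇒≤ h<))) (∣-trans (2^-∣ (n≤1+n h)) (2^∣2*node {h} (offset (toℕ c) h))))
    (subst (λ z → 2 ^ h ∣ 2 * z) (≡-sym (colNode c h<))
      (∣-trans (2^-∣ (≤-trans (n≤1+n h) (n≤1+n (suc h)))) (2^∣2*node {suc h} (offset (toℕ c) (suc h))))))
  cols .separated (h , h< , inj₁ (refl , _)) (h′ , h′< , inj₁ (_ , refl)) a _ = cols-apart (<⇒≤ h<) h′< a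
  cols .separated (h , h< , inj₁ (refl , _)) (h′ , h′< , inj₂ (_ , refl)) a _ = cols-apart (<⇒≤ h<) (<⇒≤ h′<) a
  cols .separated (h , h< , inj₂ (refl , _)) (h′ , h′< , inj₁ (_ , refl)) a _ = cols-apart h< h′< a
  cols .separated (h , h< , inj₂ (refl , _)) (h′ , h′< , inj₂ (_ , refl)) a _ = cols-apart h< (<⇒≤ h′<) a

  cw-dyadic : ∀ {k} → Fin m → Cw≤ (dyadic K) k → m ≤ 2 * k
  cw-dyadic = cw-grid (dyadic K) rows cols λ r c →
    -- Column `c` passes through valuation 2r exactly at its index 2r, and there it is literally a
    -- vertex of row `r`.
    offset (toℕ c) (2 * toℕ r) , 2 * toℕ r , offset≤ c (2 * toℕ r) , 2r≤2m r , refl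

-- Interval partitions

-- A list of cuts stands for the interval partition of ℕ in which c and c + 1 are separated
-- exactly when c is in the list; the label of v is the number of cuts to its left.
below : List ℕ → ℕ → ℕ
below A v = length (filter (_<? v) A)

below-∷-< : ∀ {c v} A → c < v → below (c ∷ A) v ≡ suc (below A v)
below-∷-< {v = v} A c<v = cong length (filter-accept (_<? v) c<v)

below-∷-≥ : ∀ {c v} A → v ≤ c → below (c ∷ A) v ≡ below A v
below-∷-≥ {v = v} A v≤c = cong length (filter-reject (_<? v) (≤⇒≯ v≤c))

below-mono : ∀ A {u v} → u ≤ v → below A u ≤ below A v
below-mono [] u≤v = z≤n
below-mono (c ∷ A) {u} {v} u≤v with <-≤-connex c u
... | inj₁ c<u rewrite below-∷-< A c<u | below-∷-< A (<-≤-trans c<u u≤v) = s≤s (below-mono A u≤v)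
... | inj₂ u≤c rewrite below-∷-≥ A u≤c with <-≤-connex c v
...   | inj₁ c<v rewrite below-∷-< A c<v = m≤n⇒m≤1+n (below-mono A u≤v)
...   | inj₂ v≤c rewrite below-∷-≥ A v≤c = below-mono A u≤v

below-flat : ∀ A {u v} → u ≤ v → (∀ {c} → c ∈ A → u ≤ c → v ≤ c) → below A u ≡ below A v
below-flat [] u≤v none = refl
below-flat (c ∷ A) {u} {v} u≤v none with <-≤-connex c u
... | inj₁ c<u rewrite below-∷-< A c<u | below-∷-< A (<-≤-trans c<u u≤v) = cong suc (below-flat A u≤v (none ∘ there))
... | inj₂ u≤c rewrite below-∷-≥ A u≤c | below-∷-≥ A (none (here refl) u≤c) = below-flat A u≤v (none ∘ there)

below-strict : ∀ {A c u v} → c ∈ A → u ≤ c → c < v → below A u < below A v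
below-strict {c ∷ A} (here refl) u≤c c<v
  rewrite below-∷-< A c<v | below-∷-≥ A u≤c = s≤s (below-mono A (≤-trans u≤c (<⇒≤ c<v)))
below-strict {d ∷ A} {u = u} {v} (there c∈A) u≤c c<v with <-≤-connex d u
... | inj₁ d<u rewrite below-∷-< A d<u | below-∷-< A (<-trans d<u (≤-<-trans u≤c c<v)) = s≤s (below-strict c∈A u≤c c<v)
... | inj₂ u≤d rewrite below-∷-≥ A u≤d with <-≤-connex d v
...   | inj₁ d<v rewrite below-∷-< A d<v = m<n⇒m<1+n (below-strict c∈A u≤c c<v)
...   | inj₂ v≤d rewrite below-∷-≥ A v≤d = below-strict c∈A u≤c c<v

below-injective : ∀ {A u v} → (∀ {c} → u ≤ c → c < v → c ∈ A) → (∀ {c} → v ≤ c → c < u → c ∈ A) →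
                  below A u ≡ below A v → u ≡ v
below-injective {u = u} {v} between between′ q with <-cmp u v
... | tri< u<v _ _ = contradiction q (<⇒≢ (below-strict (between ≤-refl u<v) ≤-refl u<v))
... | tri≈ _ u≡v _ = u≡v
... | tri> _ _ v<u = contradiction (≡-sym q) (<⇒≢ (below-strict (between′ ≤-refl v<u) ≤-refl v<u))

module _ {N : ℕ} where

  cutLabelling : List ℕ → Labelling N
  cutLabelling A v = below A (toℕ v)

  module _ {c : ℕ} {A : List ℕ} (c∉A : c ∉ A) (c< : suc c < N) where

    private
      f g : ℕ → ℕ
      f = below (c ∷ A)
      g = below A

      flat : g c ≡ g (suc c)
      flat = below-flat A (n≤1+n c) λ d∈A c≤d →
        ≤∧≢⇒< c≤d λ { refl → c∉A d∈A }

      not-across : ∀ {u v} → u ≤ c → c < v → f u ≢ f v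
      not-across {u} {v} u≤c c<v rewrite below-∷-≥ A u≤c | below-∷-< A c<v =
        <⇒≢ (s≤s (below-mono A (≤-trans u≤c (<⇒≤ c<v))))

      f-refines-g : ∀ u v → f u ≡ f v → g u ≡ g v
      f-refines-g u v q with <-≤-connex c u | <-≤-connex c v
      ... | inj₁ c<u | inj₂ v≤c = contradiction (≡-sym q) (not-across v≤c c<u)
      ... | inj₂ u≤c | inj₁ c<v = contradiction q (not-across u≤c c<v)
      ... | inj₁ c<u | inj₁ c<v rewrite below-∷-< A c<u | below-∷-< A c<v = suc-injective q
      ... | inj₂ u≤c | inj₂ v≤c rewrite below-∷-≥ A u≤c | below-∷-≥ A v≤c = q

      Merging : ℕ → ℕ → ℕ → Set
      Merging a b u = (f u ≡ f a) ⊎ (f u ≡ f b)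

      -- Monotonicity squeezes `g` to a constant between `u` and `v`. So `u` shares the part ending
      -- at `c`, and `v` the part starting at `c + 1`; these are the two parts merged.
      across : ∀ u v → u ≤ c → c < v → g u ≡ g v → (f u ≡ f c) × (f v ≡ f (suc c))
      across u v u≤c c<v q =
        trans (below-∷-≥ A u≤c) (trans (≤-antisym (below-mono A u≤c) gc≤gu) (≡-sym (below-∷-≥ A ≤-refl))) ,
        trans (below-∷-< A c<v) (trans (cong suc (≤-antisym gv≤gsc (below-mono A c<v))) (≡-sym (below-∷-< A ≤-refl)))
        where
        gc≤gu : g c ≤ g u
        gc≤gu = subst (g c ≤_) (≡-sym q) (below-mono A (<⇒≤ c<v))
        gv≤gsc : g v ≤ g (suc c)
        gv≤gsc = subst (_≤ g (suc c)) q (below-mono A (m≤n⇒m≤1+n u≤c))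

      module _ (a b : ℕ) (a≡c : a ≡ c) (b≡1+c : b ≡ suc c) where

        g⇒merged : ∀ u v → g u ≡ g v → (f u ≡ f v) ⊎ (Merging a b u × Merging a b v)
        g⇒merged u v q rewrite a≡c | b≡1+c with <-≤-connex c u | <-≤-connex c v
        ... | inj₁ c<u | inj₁ c<v = inj₁ (trans (below-∷-< A c<u) (trans (cong suc q) (≡-sym (below-∷-< A c<v))))
        ... | inj₂ u≤c | inj₂ v≤c = inj₁ (trans (below-∷-≥ A u≤c) (trans q (≡-sym (below-∷-≥ A v≤c))))
        ... | inj₂ u≤c | inj₁ c<v = let qu , qv = across u v u≤c c<v q in inj₂ (inj₁ qu , inj₂ qv)
        ... | inj₁ c<u | inj₂ v≤c = let qv , qu = across v u v≤c c<u (≡-sym q) in inj₂ (inj₂ qu , inj₁ qv)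

        merging⇒g : ∀ {u} → Merging a b u → g u ≡ g c
        merging⇒g (inj₁ q) rewrite a≡c = f-refines-g _ _ q
        merging⇒g (inj₂ q) rewrite b≡1+c = trans (f-refines-g _ _ q) (≡-sym flat)

        merged⇒g : ∀ u v → (f u ≡ f v) ⊎ (Merging a b u × Merging a b v) → g u ≡ g v
        merged⇒g u v (inj₁ q) = f-refines-g u v q
        merged⇒g u v (inj₂ (qu , qv)) = trans (merging⇒g qu) (≡-sym (merging⇒g qv))

    uncut-merges : MergeOf (cutLabelling (c ∷ A)) (cutLabelling A)
    uncut-merges = a , b , not-across (≤-reflexive a≡c) (≤-reflexive (≡-sym b≡1+c)) ,
      λ u v → g⇒merged (toℕ a) (toℕ b) a≡c b≡1+c (toℕ u) (toℕ v) , merged⇒g (toℕ a) (toℕ b) a≡c b≡1+c (toℕ u) (toℕ v)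
      where
      a b : Fin N
      a = fromℕ< (<⇒≤ c<)
      b = fromℕ< c<
      a≡c : toℕ a ≡ c
      a≡c = Fin.toℕ-fromℕ< (<⇒≤ c<)
      b≡1+c : toℕ b ≡ suc c
      b≡1+c = Fin.toℕ-fromℕ< c<

-- Uniqueness guarantees that a dropped cut does not recur later, so that each drop really merges
-- two parts.
drop-step : ∀ {L : List ℕ} {t} → Unique L → t < length L →
            ∃[ c ] c ∈ L × c ∉ drop (suc t) L × drop t L ≡ c ∷ drop (suc t) L
drop-step {c ∷ L} {zero} (c∉L ∷ _) _ = c , here refl , (λ c∈L → lookup c∉L c∈L refl) , refl
drop-step {d ∷ L} {suc t} (_ ∷ uniq) (s≤s t<) =
  let c , c∈L , c∉ , q = drop-step uniq t< in c , there c∈L , c∉ , q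

module _ (N : ℕ) {L : List ℕ} (L↭cuts : L ↭ upTo (N ∸ 1)) where

  cuts-∈ : ∀ {c} → suc c < N → c ∈ L
  cuts-∈ (s≤s c<) = ∈-resp-↭ (↭-sym L↭cuts) (∈-upTo⁺ c<)

  private
    cut-bound : ∀ {c} → c ∈ L → suc c < N
    cut-bound c∈L = suc-< (∈-upTo⁻ (∈-resp-↭ L↭cuts c∈L))
      where
      suc-< : ∀ {c M} → c < M ∸ 1 → suc c < M
      suc-< {M = suc M} c<M = s≤s c<M

    length-cuts : length L ≡ N ∸ 1
    length-cuts = trans (↭-length L↭cuts) (length-upTo (N ∸ 1))

    unique : Unique L
    unique = PermSetoid.Unique-resp-↭ (setoid ℕ) (↭⇒↭ₛ (↭-sym L↭cuts)) (upTo⁺ (N ∸ 1))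

  uncutting : PartitionSequence N
  uncutting .PartitionSequence.P t = cutLabelling (drop t L)
  uncutting .PartitionSequence.start u v q =
    Fin.toℕ-injective (below-injective (λ _ c<v → cuts-∈ (≤-<-trans c<v (Fin.toℕ<n v)))
                                       (λ _ c<u → cuts-∈ (≤-<-trans c<u (Fin.toℕ<n u))) q)
  uncutting .PartitionSequence.step t t< =
    let c , c∈L , c∉ , q = drop-step unique (subst (t <_) (≡-sym length-cuts) t<)
    in subst (λ A → MergeOf (cutLabelling {N} A) (cutLabelling (drop (suc t) L))) (≡-sym q)
             (uncut-merges c∉ (cut-bound c∈L))
  uncutting .PartitionSequence.finish u v
    rewrite drop-all (N ∸ 1) L (≤-reflexive length-cuts) = refl

-- The stretch-width of the dyadic graphs

Touches : ℕ → ℕ → Set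
Touches j c = 2 ^ j ∣ c ⊎ 2 ^ j ∣ suc c

touches? : ∀ j c → Dec (Touches j c)
touches? j c = (2 ^ j ∣? c) ⊎-dec (2 ^ j ∣? suc c)

-- The larger 2-adic valuation of the two numbers next to the cut, capped at `K`; the cap takes care
-- of 0.
stage : ℕ → ℕ → ℕ
stage zero c = 0
stage (suc K) c with touches? (suc K) c
... | yes _ = suc K
... | no _  = stage K c

stage-touches : ∀ K {i c} → i ≤ stage K c → Touches i c
stage-touches zero {c = c} z≤n = inj₁ (1∣ c)
stage-touches (suc K) {c = c} i≤ with touches? (suc K) c
... | yes (inj₁ d) = inj₁ (∣-trans (2^-∣ i≤) d)
... | yes (inj₂ d) = inj₂ (∣-trans (2^-∣ i≤) d)
... | no _         = stage-touches K i≤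

touches-stage : ∀ {K j c} → j ≤ K → Touches j c → j ≤ stage K c
touches-stage {zero} z≤n _ = z≤n
touches-stage {suc K} {c = c} j≤ tj with touches? (suc K) c
... | yes _ = j≤
... | no ¬t with m≤n⇒m<n∨m≡n j≤
...   | inj₁ (s≤s j≤K) = touches-stage j≤K tj
...   | inj₂ refl      = contradiction tj ¬t

-- The threshold is the largest key dropped so far, or 0 if nothing was dropped. Cuts whose key
-- equals it may be partly dropped, hence the strict inequality in the second half.
drop-threshold : ∀ (key : ℕ → ℕ) {L} → AllPairs (λ c d → key c ≤ key d) L → ∀ t →
  ∃[ i ] (∀ {c} → c ∈ drop t L → i ≤ key c) × (∀ {c} → c ∈ L → i < key c → c ∈ drop t L)
drop-threshold key _ zero = 0 , (λ _ → z≤n) , (λ c∈ _ → c∈)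
drop-threshold key [] (suc t) = 0 , (λ ()) , (λ ())
drop-threshold key {c ∷ L} (c≤ ∷ sorted) (suc t) with drop-threshold key sorted t
... | i , alive , kept = i ⊔ key c ,
  (λ d∈ → ⊔-lub (alive d∈) (lookup c≤ (drop-⊆ t d∈))) ,
  λ { (here refl) lt → contradiction lt (≤⇒≯ (m≤n⊔m i (key c)))
    ; (there d∈) lt → kept d∈ (≤-<-trans (m≤m⊔n i (key c)) lt) }
  where
  drop-⊆ : ∀ t {L : List ℕ} {d} → d ∈ drop t L → d ∈ L
  drop-⊆ zero d∈ = d∈
  drop-⊆ (suc t) {_ ∷ _} d∈ = there (drop-⊆ t d∈)

module _ (D : ℕ) .{{_ : NonZero D}} where

  next-multiple : ∀ u → ∃[ q ] D ∣ q × u < q × q ≤ u + D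
  next-multiple u = D + u / D * D , ∣m∣n⇒∣m+n ∣-refl (n∣m*n (u / D)) ,
    subst (_< D + u / D * D) (≡-sym (m≡m%n+[m/n]*n u D)) (+-monoˡ-< (u / D * D) (m%n<n u D)) ,
    subst (D + u / D * D ≤_) (+-comm D u) (+-monoʳ-≤ D (subst (u / D * D ≤_) (≡-sym (m≡m%n+[m/n]*n u D)) (m≤n+m (u / D * D) (u % D))))

  no-multiple : ∀ {b q} → D ∣ q → b * D < q → ¬ q < suc b * D
  no-multiple {b} (divides-refl k) b< <1+b =
    <⇒≱ (*-cancelʳ-< D k (suc b) <1+b) (*-cancelʳ-< D b k b<)

  -- A window of length 12 D meets at most 13 blocks [b D, (b + 1) D), and in each of them f
  -- takes at most two values.
  window-values : (f : ℕ → ℕ) → (∀ b w → suc (b * D) ≤ w → w < suc b * D → f w ≡ f (suc (b * D))) →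
                  ∀ s → ∃[ L ] length L ≤ 26 × (∀ w → s ≤ w → w ≤ s + 12 * D → f w ∈ L)
  window-values f const s = map first (upTo 13) ++ map later (upTo 13) , ≤-refl , covered
    where
    first later : ℕ → ℕ
    first o = f ((s / D + o) * D)
    later o = f (suc ((s / D + o) * D))

    covered : ∀ w → s ≤ w → w ≤ s + 12 * D → f w ∈ map first (upTo 13) ++ map later (upTo 13)
    covered w s≤w w≤ = value (m≡m%n+[m/n]*n w D) (m%n<n w D)
      where
      o : ℕ
      o = w / D ∸ s / D
      block : s / D + o ≡ w / D
      block = m+[n∸m]≡n (/-monoˡ-≤ D s≤w)
      last-block : w / D ≤ s / D + 12
      last-block = begin
        w / D                  ≤⟨ /-monoˡ-≤ D w≤ ⟩
        (s + 12 * D) / D       ≡⟨ +-distrib-/-∣ʳ s (n∣m*n 12) ⟩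
        s / D + 12 * D / D     ≡⟨ cong (s / D +_) (m*n/n≡m 12 D) ⟩
        s / D + 12             ∎
        where open ≤-Reasoning
      o∈ : o ∈ upTo 13
      o∈ = ∈-upTo⁺ (s≤s (m≤n+o⇒m∸n≤o (w / D) (s / D) last-block))
      value : ∀ {r} → w ≡ r + w / D * D → r < D → f w ∈ map first (upTo 13) ++ map later (upTo 13)
      value {zero} w≡ _ = ∈-++⁺ˡ (subst (_∈ map first (upTo 13))
        (trans (cong (λ b → f (b * D)) block) (cong f (≡-sym w≡))) (∈-map⁺ first o∈))
      value {suc r} w≡ r<D = ∈-++⁺ʳ (map first (upTo 13)) (subst (_∈ map later (upTo 13))
        (trans (cong (λ b → f (suc (b * D))) block)
               (≡-sym (const (w / D) w (subst (suc (w / D * D) ≤_) (≡-sym w≡) (s≤s (m≤n+m _ r)))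
                                       (subst (_< D + w / D * D) (≡-sym w≡) (+-monoˡ-< (w / D * D) r<D)))))
        (∈-map⁺ later o∈))

-- Once the cuts of stage below i and possibly some of stage i are gone, parts have diameter at
-- most 2 ^ (i + 1), and endpoints of edges longer than that are still singletons.
module Coarse (K i : ℕ) (A : List ℕ)
              (late  : ∀ {c} → c ∈ A → i ≤ stage K c)
              (alive : ∀ {c} → suc c < 2 ^ K → i < stage K c → c ∈ A) where

  f : ℕ → ℕ
  f = below A

  S : ℕ
  S = 2 ^ suc i

  V : Set
  V = Fin (2 ^ K)

  -- The cut just before a multiple of `S` has stage at least `i + 1` and is thus still present.
  separated-by : ∀ {u q v} → S ∣ q → u < q → q ≤ v → v < 2 ^ K → f u < f v
  separated-by {q = suc c} S∣q u<q q≤v v< =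
    -- A positive multiple of `S` below 2^K forces `i + 1 ≤ K`, so the cap in `stage` does no harm.
    below-strict (alive q< (touches-stage {K} (2^-cancel-≤ {suc i} {K} (≤-trans (∣⇒≤ S∣q) (<⇒≤ q<))) (inj₂ S∣q)))
                 (≤-pred u<q) q≤v
    where q< = ≤-<-trans q≤v v<

  diameter-≤ : ∀ {u v} → f u ≡ f v → v < 2 ^ K → v ≤ u + S
  diameter-≤ {u} {v} q v< with next-multiple S {{m^n≢0 2 (suc i)}} u
  ... | p , S∣p , u<p , p≤ with p ≤? v
  ...   | yes p≤v = contradiction q (<⇒≢ (separated-by S∣p u<p p≤v v<))
  ...   | no p≰v = ≤-trans (<⇒≤ (≰⇒> p≰v)) p≤

  diameter : ∀ {u v : V} → f (toℕ u) ≡ f (toℕ v) → ∣ toℕ u - toℕ v ∣ ≤ S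
  diameter {u} {v} q with ∣m-n∣≡[m∸n]∨[n∸m] (toℕ u) (toℕ v)
  ... | inj₁ e = subst (_≤ S) (≡-sym e) (m≤n+o⇒m∸n≤o (toℕ u) (toℕ v) (diameter-≤ (≡-sym q) (Fin.toℕ<n u)))
  ... | inj₂ e = subst (_≤ S) (≡-sym e) (m≤n+o⇒m∸n≤o (toℕ v) (toℕ u) (diameter-≤ q (Fin.toℕ<n v)))

  -- The cuts on both sides of a multiple of `S` survive: the one after it separates larger
  -- vertices, the one before it smaller ones.
  singleton : ∀ {u v : V} → S ∣ toℕ u → suc i ≤ K → f (toℕ u) ≡ f (toℕ v) → u ≡ v
  singleton {u} {v} S∣u i<K q with <-cmp (toℕ u) (toℕ v)
  ... | tri< u<v _ _ = contradiction q (<⇒≢ (below-strict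
          (alive (≤-<-trans u<v (Fin.toℕ<n v)) (touches-stage {K} i<K (inj₁ S∣u))) ≤-refl u<v))
  ... | tri≈ _ u≡v _ = Fin.toℕ-injective u≡v
  ... | tri> _ _ v<u = contradiction (≡-sym q) (<⇒≢ (separated-by S∣u v<u ≤-refl (Fin.toℕ<n u)))

  long-edge : ∀ {j p} → suc i < j → 2 ^ j ∣ 2 * p → S ∣ p
  long-edge i<j d = *-cancelˡ-∣ 2 (∣-trans (2^-∣ i<j) d)

  labelling : Labelling (2 ^ K)
  labelling = cutLabelling A

  -- The edge witnessing inhomogeneity is short: if its exponent exceeded `i + 1`, both ends would
  -- be multiples of `S`, both parts singletons, and the non-edge would be the same pair.
  red-short : ∀ {x y} → Inhomogeneous (dyadic K) labelling x y →
              ∃[ u ] ∃[ v ] labelling u ≡ x × labelling v ≡ y × ∣ toℕ u - toℕ v ∣ ≤ S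
  red-short (_ , u , u′ , v , v′ , fu , fu′ , fv , fv′ , uv , u′v′) = u , v , fu , fv , short (adj⇒adjacent K uv)
    where
    differ : u ≡ u′ → v ≢ v′
    differ refl refl with () ← trans (≡-sym uv) u′v′
    short : Adjacent K (toℕ u) (toℕ v) → ∣ toℕ u - toℕ v ∣ ≤ S
    short (adjacent {j} j<K d du dv) with j ≤? suc i
    ... | yes j≤ = ≤-trans (≤-reflexive d) (2^-mono j≤)
    ... | no j≰ = contradiction (singleton (long-edge {p = toℕ v} i<j dv) i<K (trans fv (≡-sym fv′)))
                                (differ (singleton (long-edge {p = toℕ u} i<j du) i<K (trans fu (≡-sym fu′))))
      where
      i<j = ≰⇒> j≰
      i<K = <⇒≤ (<-trans i<j j<K)

  module _ {x : ℕ} {x₀ : V} (fx₀ : labelling x₀ ≡ x) where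

    near : ∀ {w} → ClosedNbhdUnion (dyadic K) (↔-id V) labelling x w → ∣ toℕ x₀ - toℕ w ∣ ≤ 3 * S
    near {w} (inj₁ fw) = ≤-trans (diameter (trans fx₀ (≡-sym fw))) (m≤m+n S _)
    near {w} (inj₂ red) = let u , v , fu , fv , uv = red-short red in begin
      ∣ toℕ x₀ - toℕ w ∣    ≤⟨ ∣-∣-path (toℕ x₀) (toℕ u) (toℕ v) (toℕ w) ⟩
      ∣ toℕ x₀ - toℕ u ∣ + (∣ toℕ u - toℕ v ∣ + ∣ toℕ v - toℕ w ∣)
                            ≤⟨ +-mono-≤ (diameter (trans fx₀ (≡-sym fu))) (+-mono-≤ uv (diameter fv)) ⟩
      S + (S + S)           ≡⟨ cong (λ z → S + (S + z)) (+-identityʳ S) ⟨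
      3 * S                 ∎
      where open ≤-Reasoning

    -- The window reaches 3S to either side of `x₀`, so its length is 6S = 12 * 2^i. Truncation at 0
    -- preserves x₀ ≤ leftEnd + 3S.
    leftEnd : ℕ
    leftEnd = toℕ x₀ ∸ 3 * S

    -- Parts are intervals, so the common point of the two spans belongs to part `y` itself, while
    -- `near` confines it to the window. Interfering parts are thus among the values of `f` there.
    interferer : ∀ {y} → Interferes (dyadic K) (↔-id V) labelling x y →
                 ∃[ w ] f w ≡ y × leftEnd ≤ w × w ≤ leftEnd + 12 * 2 ^ i
    interferer (_ , _ , w , (a , b , fa , fb , a≤w , w≤b) , (a′ , b′ , na , nb , a′≤w , w≤b′)) =
      toℕ w ,
      ≤-antisym (subst (f (toℕ w) ≤_) fb (below-mono A w≤b)) (subst (_≤ f (toℕ w)) fa (below-mono A a≤w)) ,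
      ≤-trans (m≤n+o⇒m∸n≤o (toℕ x₀) (3 * S)
        (≤-trans (m≤n+∣m-n∣ (toℕ x₀) (toℕ a′)) (≤-trans (+-monoʳ-≤ (toℕ a′) (near na)) (≤-reflexive (+-comm (toℕ a′) _))))) a′≤w ,
      ≤-trans w≤b′ (begin
        toℕ b′                              ≤⟨ m≤n+∣n-m∣ (toℕ b′) (toℕ x₀) ⟩
        toℕ x₀ + ∣ toℕ x₀ - toℕ b′ ∣        ≤⟨ +-mono-≤ (≤-trans (m≤n+m∸n (toℕ x₀) (3 * S)) (≤-reflexive (+-comm (3 * S) leftEnd))) (near nb) ⟩
        (leftEnd + 3 * S) + 3 * S           ≡⟨ rearrange leftEnd (2 ^ i) ⟩
        leftEnd + 12 * 2 ^ i                ∎)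
      where
      open ≤-Reasoning
      rearrange : ∀ s d → (s + 3 * (2 * d)) + 3 * (2 * d) ≡ s + 12 * d
      rearrange = solve-∀

  -- A surviving cut `c` has `c` or `c + 1` divisible by 2^i. The start of a block may therefore be
  -- cut off on both sides, but no cut lies among its remaining points.
  block-constant : ∀ b w → suc (b * 2 ^ i) ≤ w → w < suc b * 2 ^ i → f w ≡ f (suc (b * 2 ^ i))
  block-constant b w b<w w< = ≡-sym (below-flat A b<w λ {c} c∈A b<c → ≮⇒≥ λ c<w →
    [ (λ d → no-multiple (2 ^ i) {{m^n≢0 2 i}} {b} d b<c (<-trans c<w w<))
    , (λ d → no-multiple (2 ^ i) {{m^n≢0 2 i}} {b} d (m<n⇒m<1+n b<c) (≤-<-trans c<w w<)) ]′
    (stage-touches K (late c∈A)))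

  stretch : Stretch≤ (dyadic K) (↔-id V) labelling 26
  stretch x (x₀ , fx₀) =
    let L , L≤ , covers = window-values (2 ^ i) {{m^n≢0 2 i}} f block-constant (leftEnd fx₀)
    in L , L≤ , λ y int → let w , fw , lo , hi = interferer fx₀ int in subst (_∈ L) fw (covers w lo hi)

module _ (K : ℕ) where

  open Sort (On.decTotalOrder ≤-decTotalOrder (stage K)) using (sort; sort-↭; sort-↗)

  cuts : List ℕ
  cuts = sort (upTo (2 ^ K ∸ 1))

  cuts-↭ : cuts ↭ upTo (2 ^ K ∸ 1)
  cuts-↭ = sort-↭ (upTo (2 ^ K ∸ 1))

  cuts-sorted : AllPairs (λ c d → stage K c ≤ stage K d) cuts
  cuts-sorted = Sorted⇒AllPairs (DecTotalOrder.totalOrder (On.decTotalOrder ≤-decTotalOrder (stage K))) (sort-↗ (upTo (2 ^ K ∸ 1)))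

  dyadic-stw : Stw≤ (dyadic K) 26
  dyadic-stw = ↔-id _ , uncutting (2 ^ K) cuts-↭ , λ t _ →
    let i , late , kept = drop-threshold (stage K) cuts-sorted t
    in Coarse.stretch K i (drop t cuts) late (λ c< i< → kept (cuts-∈ (2 ^ K) cuts-↭ c<) i<)

-- The family and the comparison of logarithms

theorem2 : Σ (ℕ → Graph) λ F →
    (∀ m → ∃[ i ] m ≤ n (F i)) ×
    (∃[ c ] ∀ i → Stw≤ (F i) c) ×
    (∃[ a ] ∃[ N ] (0 < a) ×
    (∀ i k → N ≤ n (F i) → Cw≤ (F i) k →
    ⌊log₂ n (F i) ⌋ ≤ a * k * ⌈log₂ ⌈log₂ n (F i) ⌉ ⌉))
-- The shift to `suc i` ensures that the grid has at least one row.
theorem2 = (λ i → dyadic (Grid.K (suc i))) ,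
  (λ m → m , ≤-trans (m≤n+m m 2) (≤-trans (suc-n≤2^n (suc m)) (2^-mono (m≤m+n (suc m) (Grid.B (suc m)))))) ,
  (26 , λ i → dyadic-stw (Grid.K (suc i))) ,
  12 , 0 , s≤s z≤n , λ i k _ cw → bound (suc i) k (s≤s z≤n) (Grid.cw-dyadic (suc i) Fin.zero cw)
  where
  -- The logarithm of the order is K = 3m + 3 ≤ 6m ≤ 12k, which explains the constant 12. The
  -- iterated logarithm is at least 1 because K ≥ 2.
  bound : ∀ m k → 1 ≤ m → m ≤ 2 * k → ⌊log₂ 2 ^ Grid.K m ⌋ ≤ 12 * k * ⌈log₂ ⌈log₂ 2 ^ Grid.K m ⌉ ⌉
  bound m k 1≤m m≤2k = begin
    ⌊log₂ 2 ^ Grid.K m ⌋                      ≡⟨ ⌊log₂[2^n]⌋≡n (Grid.K m) ⟩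
    m + (3 + 2 * m)                           ≤⟨ +-monoʳ-≤ m (+-monoˡ-≤ (2 * m) (*-monoʳ-≤ 3 1≤m)) ⟩
    m + (3 * m + 2 * m)                       ≡⟨ collect m ⟩
    6 * m                                     ≤⟨ *-monoʳ-≤ 6 m≤2k ⟩
    6 * (2 * k)                               ≡⟨ *-assoc 6 2 k ⟨
    12 * k                                    ≡⟨ *-identityʳ (12 * k) ⟨
    12 * k * 1                                ≤⟨ *-monoʳ-≤ (12 * k) 1≤loglog ⟩
    12 * k * ⌈log₂ ⌈log₂ 2 ^ Grid.K m ⌉ ⌉     ∎
    where
    open ≤-Reasoning
    collect : ∀ m → m + (3 * m + 2 * m) ≡ 6 * m
    collect = solve-∀
    1≤loglog : 1 ≤ ⌈log₂ ⌈log₂ 2 ^ Grid.K m ⌉ ⌉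
    1≤loglog = begin
      ⌈log₂ 2 ^ 1 ⌉                  ≤⟨ ⌈log₂⌉-mono-≤ (≤-trans (m≤m+n 2 (1 + 2 * m)) (m≤n+m (Grid.B m) m)) ⟩
      ⌈log₂ Grid.K m ⌉               ≡⟨ cong ⌈log₂_⌉ (⌈log₂2^n⌉≡n (Grid.K m)) ⟨
      ⌈log₂ ⌈log₂ 2 ^ Grid.K m ⌉ ⌉   ∎
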